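{- There exist, for each positive integer $m$, a total function $f_m:\{0,1\}^m\to\{0,1\}$, a probability distribution $\mu_m$ on $\{0,1\}^m$ and an error parameter $\varepsilon_m>0$ such that, as $m\to\infty$, $$\limsup_{n\to\infty}\frac{D^{\mu_m^n}_{\varepsilon_m}(f_m^n)}{n}=O(1)\quad\text{and}\quad D^{\mu_m}_{\varepsilon_m}(f_m)=\Omega(m),$$ where the constants implicit in $O(1)$ and $\Omega(m)$ are independent of $m$.
   Context: A deterministic query algorithm is a decision tree that adaptively queries single bits of the input. For a function $g:\mathcal{Y}\to\mathcal{W}$ on bit strings, a distribution $\nu$ on $\mathcal{Y}$ and an error parameter $\varepsilon$, $D^\nu_\varepsilon(g)$ is the minimum, over deterministic decision trees $T$ with $\Pr_{y\sim\nu}[T(y)\ne g(y)]\le\varepsilon$, of the maximum number of queries made by $T$ on an input $y\in\operatorname{supp}(\nu)$. For $f:\{0,1\}^m\to\{0,1\}$, $f^n:(\{0,1\}^m)^n\to\{0,1\}^n$ is $f^n(x_1,\dots,x_n)=(f(x_1),\dots,f(x_n))$ (correct only if all $n$ coordinates are correct), and $\mu^n$ denotes the $n$-fold product distribution of $\mu$. -}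

module Defs where

open import Data.Bool using (Bool; true; false; if_then_else_)
open import Data.Bool.Instances public
open import Data.Fin using (Fin; zero; suc)
import Data.Integer as ℤ
open import Data.List as List using (List; []; _∷_; _++_; foldr; filter; map; allFin; cartesianProductWith; cartesianProduct)
open import Data.List.Properties using (map-++)
open import Data.List.Extrema.Nat using (max; min; max≤v⁺; xs≤max; min≤⊤; min≤xs; argmin-sel)
open import Data.List.Membership.Propositional using (_∈_; find)
open import Data.List.Membership.Propositional.Properties
  using (∈-map⁺; ∈-map⁻; ∈-++⁺ˡ; ∈-++⁺ʳ; ∈-filter⁺; ∈-filter⁻; ∈-allFin; ∈-cartesianProductWith⁺; ∈-cartesianProduct⁺)
open import Data.List.Relation.Unary.All as All using (All)
open import Data.List.Relation.Unary.All.Properties using (map⁺; map⁻)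
open import Data.List.Relation.Unary.Any using (here; there; any?)
open import Data.Nat as ℕ using (ℕ; zero; suc; NonZero; z≤n; s≤s)
import Data.Nat.Properties as ℕ
open import Data.Product using (Σ-syntax; ∃-syntax; _×_; _,_; proj₁; proj₂)
open import Data.Rational as ℚ using (ℚ; 0ℚ; 1ℚ; _+_; _*_; _≤_; _<_; _/_)
import Data.Rational.Properties as ℚ
open import Data.Sum using (inj₁; inj₂)
open import Data.Vec as Vec using (Vec; []; _∷_; lookup; group)
open import Data.Vec.Instances public
open import Function using (_∘_)
open import Level using (Level)
open import Relation.Binary.PropositionalEquality
  using (_≡_; _≢_; refl; sym; trans; cong; cong₂; subst; module ≡-Reasoning)
open import Relation.Binary.TypeClasses using (IsDecEquivalence; _≟_)
open import Relation.Nullary using (yes; no; ¬?; contradiction)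
open import Relation.Unary using (Pred; Decidable)

private variable
  a p : Level
  A : Set a
  W : Set
  k m n N : ℕ

∑ : List A → (A → ℚ) → ℚ
∑ xs h = foldr (λ x s → h x + s) 0ℚ xs

bitStrings : ∀ N → List (Vec Bool N)
bitStrings zero    = [] ∷ []
bitStrings (suc N) = map (false ∷_) (bitStrings N) ++ map (true ∷_) (bitStrings N)

∈-bitStrings : (y : Vec Bool N) → y ∈ bitStrings N
∈-bitStrings []          = here refl
∈-bitStrings (false ∷ y) = ∈-++⁺ˡ (∈-map⁺ (false ∷_) (∈-bitStrings y))
∈-bitStrings (true ∷ y)  = ∈-++⁺ʳ (map (false ∷_) (bitStrings _)) (∈-map⁺ (true ∷_) (∈-bitStrings y))

record Distribution (N : ℕ) : Set where
  field
    pmf    : Vec Bool N → ℚ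
    pmf≥0  : ∀ y → 0ℚ ≤ pmf y
    ∑pmf≡1 : ∑ (bitStrings N) pmf ≡ 1ℚ

open Distribution public

Pr : Distribution N → {P : Pred (Vec Bool N) p} → Decidable P → ℚ
Pr {N = N} ν P? = ∑ (filter P? (bitStrings N)) (pmf ν)

supp : Distribution N → List (Vec Bool N)
supp {N} ν = filter (λ y → 0ℚ ℚ.<? pmf ν y) (bitStrings N)

data DecisionTree (N : ℕ) (W : Set) : Set where
  leaf  : W → DecisionTree N W
  query : Fin N → (if0 if1 : DecisionTree N W) → DecisionTree N W

run : DecisionTree N W → Vec Bool N → W
run (leaf w)        y = w
run (query i t₀ t₁) y = if lookup y i then run t₁ y else run t₀ y

queries : DecisionTree N W → Vec Bool N → ℕ
queries (leaf w)        y = 0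
queries (query i t₀ t₁) y = suc (if lookup y i then queries t₁ y else queries t₀ y)

maxQueries : Distribution N → DecisionTree N W → ℕ
maxQueries ν T = max 0 (map (queries T) (supp ν))

module _ {{_ : IsDecEquivalence {A = W} _≡_}} where

  error : Distribution N → DecisionTree N W → (Vec Bool N → W) → ℚ
  error ν T g = Pr ν (λ y → ¬? (run T y ≟ g y))

-- All trees of depth at most the given bound with leaf labels from the list.
trees : ℕ → List W → List (DecisionTree N W)
trees         zero    ws = map leaf ws
trees {N = N} (suc d) ws = map leaf ws ++
  cartesianProductWith (λ i (t₀ , t₁) → query i t₀ t₁)
    (allFin N) (cartesianProduct (trees d ws) (trees d ws))

shift : DecisionTree N W → DecisionTree (suc N) W
shift (leaf w)        = leaf w
shift (query i t₀ t₁) = query (suc i) (shift t₀) (shift t₁)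

readAll : (Vec Bool N → W) → DecisionTree N W
readAll {zero}  g = leaf (g [])
readAll {suc N} g = query zero (shift (readAll (g ∘ (false ∷_)))) (shift (readAll (g ∘ (true ∷_))))

module _ {{_ : IsDecEquivalence {A = W} _≡_}} where

  candidates : Distribution N → ℚ → (Vec Bool N → W) → List (DecisionTree N W)
  candidates {N} ν ε g = filter (λ T → error ν T g ℚ.≤? ε) (trees N (map g (bitStrings N)))

  -- The minimum is taken over a finite list of trees so that it is computable;
  -- D-attained and D-minimal show that it is the minimum over all trees.
  -- For ε < 0 no tree qualifies and the value is meaningless.
  D : Distribution N → ℚ → (Vec Bool N → W) → ℕ
  D ν ε g = min (maxQueries ν (readAll g)) (map (maxQueries ν) (candidates ν ε g))

run-shift : ∀ (T : DecisionTree N W) b y → run (shift T) (b ∷ y) ≡ run T y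
run-shift (leaf w) b y = refl
run-shift (query i t₀ t₁) b y with lookup y i
... | true  = run-shift t₁ b y
... | false = run-shift t₀ b y

queries-shift : ∀ (T : DecisionTree N W) b y → queries (shift T) (b ∷ y) ≡ queries T y
queries-shift (leaf w) b y = refl
queries-shift (query i t₀ t₁) b y with lookup y i
... | true  = cong suc (queries-shift t₁ b y)
... | false = cong suc (queries-shift t₀ b y)

run-readAll : ∀ (g : Vec Bool N → W) y → run (readAll g) y ≡ g y
run-readAll g []          = refl
run-readAll g (false ∷ y) = trans (run-shift (readAll (g ∘ (false ∷_))) false y) (run-readAll (g ∘ (false ∷_)) y)
run-readAll g (true ∷ y)  = trans (run-shift (readAll (g ∘ (true ∷_))) true y) (run-readAll (g ∘ (true ∷_)) y)

queries-readAll : ∀ (g : Vec Bool N → W) y → queries (readAll g) y ≡ N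
queries-readAll g []          = refl
queries-readAll g (false ∷ y) = cong suc (trans (queries-shift (readAll (g ∘ (false ∷_))) false y) (queries-readAll (g ∘ (false ∷_)) y))
queries-readAll g (true ∷ y)  = cong suc (trans (queries-shift (readAll (g ∘ (true ∷_))) true y) (queries-readAll (g ∘ (true ∷_)) y))

maxQueries-lub : ∀ (ν : Distribution N) (T : DecisionTree N W) {d} →
                 (∀ y → y ∈ supp ν → queries T y ℕ.≤ d) → maxQueries ν T ℕ.≤ d
maxQueries-lub ν T h = max≤v⁺ z≤n (map⁺ (All.tabulate (λ {y} → h y)))

queries≤maxQueries : ∀ (ν : Distribution N) (T : DecisionTree N W) {y} →
                     y ∈ supp ν → queries T y ℕ.≤ maxQueries ν T
queries≤maxQueries ν T = All.lookup (map⁻ (xs≤max 0 (map (queries T) (supp ν))))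

private
  ∑-filter-mono : ∀ {q} {P : Pred A p} {Q : Pred A q} (P? : Decidable P) (Q? : Decidable Q)
                  (h : A → ℚ) → (∀ x → 0ℚ ≤ h x) → (∀ x → 0ℚ < h x → P x → Q x) →
                  ∀ xs → ∑ (filter P? xs) h ≤ ∑ (filter Q? xs) h
  ∑-filter-mono P? Q? h h≥0 P⇒Q [] = ℚ.≤-refl
  ∑-filter-mono P? Q? h h≥0 P⇒Q (x ∷ xs)
    with ih ← ∑-filter-mono P? Q? h h≥0 P⇒Q xs | P? x | Q? x
  ... | yes _ | yes _ = ℚ.+-monoʳ-≤ (h x) ih
  ... | no  _ | no  _ = ih
  ... | no  _ | yes _ = subst (_≤ h x + ∑ (filter Q? xs) h) (ℚ.+-identityˡ (∑ (filter P? xs) h)) (ℚ.+-mono-≤ (h≥0 x) ih)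
  ... | yes Px | no ¬Qx = 
    subst (_≤ ∑ (filter Q? xs) h)
      (sym (trans (cong (_+ ∑ (filter P? xs) h) hx≡0) (ℚ.+-identityˡ (∑ (filter P? xs) h)))) ih
    where
    hx≡0 : h x ≡ 0ℚ
    hx≡0 = ℚ.≤-antisym (ℚ.≮⇒≥ (λ 0<hx → ¬Qx (P⇒Q x 0<hx Px))) (h≥0 x)

module _ {{_ : IsDecEquivalence {A = W} _≡_}} where

  error-mono : ∀ (ν : Distribution N) (T U : DecisionTree N W) g →
               (∀ y → 0ℚ < pmf ν y → run U y ≡ g y → run T y ≡ g y) →
               error ν T g ≤ error ν U g
  error-mono {N} ν T U g h =
    ∑-filter-mono _ _ (pmf ν) (pmf≥0 ν) (λ y 0<νy T≢g → T≢g ∘ h y 0<νy) (bitStrings N)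

  error-exact : ∀ (ν : Distribution N) (T : DecisionTree N W) g →
                (∀ y → run T y ≡ g y) → error ν T g ≡ 0ℚ
  error-exact {N} ν T g exact = go (bitStrings N)
    where
    go : ∀ ys → ∑ (filter (λ y → ¬? (run T y ≟ g y)) ys) (pmf ν) ≡ 0ℚ
    go [] = refl
    go (y ∷ ys) with run T y ≟ g y
    ... | yes _   = go ys
    ... | no  T≢g = contradiction (exact y) T≢g

  private
    module Prune {N} (g : Vec Bool N → W) where
      ws : List W
      ws = map g (bitStrings N)

      y₀ : Vec Bool N
      y₀ = Vec.replicate N false

      relabel : W → W
      relabel w with any? (w ≟_) ws
      ... | yes _ = w
      ... | no  _ = g y₀

      relabel∈ : ∀ w → relabel w ∈ ws
      relabel∈ w with any? (w ≟_) ws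
      ... | yes w∈ws = w∈ws
      ... | no  _    = ∈-map⁺ g (∈-bitStrings y₀)

      relabel-correct : ∀ w y → w ≡ g y → relabel w ≡ g y
      relabel-correct w y w≡gy with any? (w ≟_) ws
      ... | yes _    = w≡gy
      ... | no  w∉ws = contradiction (subst (_∈ ws) (sym w≡gy) (∈-map⁺ g (∈-bitStrings y))) w∉ws

      prune : ℕ → DecisionTree N W → DecisionTree N W
      prune d       (leaf w)        = leaf (relabel w)
      prune zero    (query _ _ _)   = leaf (g y₀)
      prune (suc d) (query i t₀ t₁) = query i (prune d t₀) (prune d t₁)

      leaf∈trees : ∀ d {w} → w ∈ ws → leaf w ∈ trees {N = N} d ws
      leaf∈trees zero    w∈ws = ∈-map⁺ leaf w∈ws
      leaf∈trees (suc d) w∈ws = ∈-++⁺ˡ (∈-map⁺ leaf w∈ws)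

      prune∈trees : ∀ d T → prune d T ∈ trees d ws
      prune∈trees d       (leaf w)        = leaf∈trees d (relabel∈ w)
      prune∈trees zero    (query _ _ _)   = leaf∈trees 0 (∈-map⁺ g (∈-bitStrings y₀))
      prune∈trees (suc d) (query i t₀ t₁) = ∈-++⁺ʳ (map leaf ws)
        (∈-cartesianProductWith⁺ _ (∈-allFin i)
          (∈-cartesianProduct⁺ (prune∈trees d t₀) (prune∈trees d t₁)))

      prune-queries : ∀ d T y → queries (prune d T) y ℕ.≤ queries T y
      prune-queries d       (leaf w)        y = z≤n
      prune-queries zero    (query _ _ _)   y = z≤n
      prune-queries (suc d) (query i t₀ t₁) y with lookup y i
      ... | true  = s≤s (prune-queries d t₁ y)
      ... | false = s≤s (prune-queries d t₀ y)

      prune-correct : ∀ d T y → queries T y ℕ.≤ d → run T y ≡ g y → run (prune d T) y ≡ g y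
      prune-correct d       (leaf w)        y _ eq = relabel-correct w y eq
      prune-correct (suc d) (query i t₀ t₁) y (s≤s q) eq with lookup y i
      ... | true  = prune-correct d t₁ y q eq
      ... | false = prune-correct d t₀ y q eq

  D-attained : ∀ (ν : Distribution N) {ε} → 0ℚ ≤ ε → (g : Vec Bool N → W) →
               ∃[ T ] error ν T g ≤ ε × maxQueries ν T ≡ D ν ε g
  D-attained {N} ν {ε} 0≤ε g
    with argmin-sel (λ d → d) (maxQueries ν (readAll g)) (map (maxQueries ν) (candidates ν ε g))
  ... | inj₁ D≡ = readAll g ,
                  subst (_≤ ε) (sym (error-exact ν (readAll g) g (run-readAll g))) 0≤ε , sym D≡
  ... | inj₂ D∈ with T , T∈ , D≡ ← ∈-map⁻ (maxQueries ν) D∈ =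
    T , proj₂ (∈-filter⁻ (λ T → error ν T g ℚ.≤? ε) {xs = trees N (map g (bitStrings N))} T∈) , sym D≡

  D-minimal : ∀ (ν : Distribution N) {ε} (g : Vec Bool N → W) T →
              error ν T g ≤ ε → D ν ε g ℕ.≤ maxQueries ν T
  D-minimal {N} ν {ε} g T err≤ε with ℕ.≤-total N (maxQueries ν T)
  ... | inj₁ N≤T = ℕ.≤-trans (min≤⊤ (maxQueries ν (readAll g)) (map (maxQueries ν) (candidates ν ε g)))
    (ℕ.≤-trans (maxQueries-lub ν (readAll g) (λ y _ → ℕ.≤-reflexive (queries-readAll g y))) N≤T)
  ... | inj₂ T≤N = ℕ.≤-trans
    (All.lookup (min≤xs (maxQueries ν (readAll g)) (map (maxQueries ν) (candidates ν ε g))) (∈-map⁺ (maxQueries ν) T′∈))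
    (maxQueries-lub ν T′ (λ y y∈ → ℕ.≤-trans (prune-queries N T y) (queries≤maxQueries ν T y∈)))
    where
    open Prune g
    T′ : DecisionTree N W
    T′ = prune N T
    T′∈ : T′ ∈ candidates ν ε g
    T′∈ = ∈-filter⁺ (λ T → error ν T g ℚ.≤? ε) (prune∈trees N T)
      (ℚ.≤-trans
        (error-mono ν T′ T g (λ y 0<νy → prune-correct N T y
          (ℕ.≤-trans (queries≤maxQueries ν T
            (∈-filter⁺ (λ y → 0ℚ ℚ.<? pmf ν y) (∈-bitStrings y) 0<νy)) T≤N)))
        err≤ε)

-- ({0,1}ᵐ)ⁿ is represented by bit strings of length n * m; y ≡ concat (blocks n y).

blocks : ∀ n → Vec Bool (n ℕ.* m) → Vec (Vec Bool m) n
blocks {m} n y = proj₁ (group n m y)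

_^ᶠ_ : (Vec Bool m → W) → ∀ n → Vec Bool (n ℕ.* m) → Vec W n
(f ^ᶠ n) y = Vec.map f (blocks n y)

∏ : Vec ℚ n → ℚ
∏ = Vec.foldr′ _*_ 1ℚ

∑-++ : ∀ (xs ys : List A) h → ∑ (xs ++ ys) h ≡ ∑ xs h + ∑ ys h
∑-++ []       ys h = sym (ℚ.+-identityˡ _)
∑-++ (x ∷ xs) ys h = trans (cong (h x +_) (∑-++ xs ys h)) (sym (ℚ.+-assoc (h x) _ _))

∑-map : ∀ {B : Set} (e : A → B) xs h → ∑ (map e xs) h ≡ ∑ xs (h ∘ e)
∑-map e []       h = refl
∑-map e (x ∷ xs) h = cong (h (e x) +_) (∑-map e xs h)

∑-bits : ∀ N h → ∑ (bitStrings (suc N)) h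
               ≡ ∑ (bitStrings N) (h ∘ (false ∷_)) + ∑ (bitStrings N) (h ∘ (true ∷_))
∑-bits N h = trans (∑-++ (map (false ∷_) (bitStrings N)) (map (true ∷_) (bitStrings N)) h)
  (cong₂ _+_ (∑-map (false ∷_) (bitStrings N) h) (∑-map (true ∷_) (bitStrings N) h))

∑-*ˡ : ∀ c (xs : List A) h → ∑ xs (λ x → c * h x) ≡ c * ∑ xs h
∑-*ˡ c []       h = sym (ℚ.*-zeroʳ c)
∑-*ˡ c (x ∷ xs) h = trans (cong (c * h x +_) (∑-*ˡ c xs h)) (sym (ℚ.*-distribˡ-+ c (h x) _))

∑-split : ∀ m k (h : Vec Bool m → ℚ) (h′ : Vec Bool k → ℚ) →
          ∑ (bitStrings (m ℕ.+ k)) (λ y → h (Vec.take m y) * h′ (Vec.drop m y))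
          ≡ ∑ (bitStrings m) h * ∑ (bitStrings k) h′
∑-split zero k h h′ = trans (∑-*ˡ (h []) (bitStrings k) h′)
  (cong (_* ∑ (bitStrings k) h′) (sym (ℚ.+-identityʳ (h []))))
∑-split (suc m) k h h′ = begin
  ∑ (bitStrings (suc m ℕ.+ k)) (λ y → h (Vec.take (suc m) y) * h′ (Vec.drop (suc m) y))
    ≡⟨ ∑-bits (m ℕ.+ k) (λ y → h (Vec.take (suc m) y) * h′ (Vec.drop (suc m) y)) ⟩
  _ ≡⟨ cong₂ _+_ (∑-split m k (h ∘ (false ∷_)) h′) (∑-split m k (h ∘ (true ∷_)) h′) ⟩
  ∑ (bitStrings m) (h ∘ (false ∷_)) * S + ∑ (bitStrings m) (h ∘ (true ∷_)) * S
    ≡⟨ ℚ.*-distribʳ-+ S (∑ (bitStrings m) (h ∘ (false ∷_))) _ ⟨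
  (∑ (bitStrings m) (h ∘ (false ∷_)) + ∑ (bitStrings m) (h ∘ (true ∷_))) * S
    ≡⟨ cong (_* S) (∑-bits m h) ⟨
  ∑ (bitStrings (suc m)) h * S ∎
  where
  open ≡-Reasoning
  S = ∑ (bitStrings k) h′

_^ᵈ_ : Distribution m → ∀ n → Distribution (n ℕ.* m)
pmf    (μ ^ᵈ n) y = ∏ (Vec.map (pmf μ) (blocks n y))
pmf≥0  (μ ^ᵈ n) y = go (blocks n y)
  where
  go : ∀ {n} (xs : Vec (Vec Bool _) n) → 0ℚ ≤ ∏ (Vec.map (pmf μ) xs)
  go []       = ℚ.<⇒≤ (ℚ.positive⁻¹ 1ℚ)
  go (x ∷ xs) = subst (_≤ pmf μ x * ∏ (Vec.map (pmf μ) xs)) (ℚ.*-zeroʳ (pmf μ x))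
    (ℚ.*-monoˡ-≤-nonNeg (pmf μ x) {{ℚ.nonNegative (pmf≥0 μ x)}} (go xs))
∑pmf≡1 (_^ᵈ_     μ zero)    = refl
∑pmf≡1 (_^ᵈ_ {m} μ (suc n)) = trans
  (∑-split m (n ℕ.* m) (pmf μ) (pmf (μ ^ᵈ n)))
  (trans (cong₂ _*_ (∑pmf≡1 μ) (∑pmf≡1 (μ ^ᵈ n))) refl)

infixl 8 _^ᶠ_ _^ᵈ_

ℕ→ℚ : ℕ → ℚ
ℕ→ℚ d = ℤ.+ d / 1

-- The limit superior is in general not rational, so only the relation
-- limsup a ≤ C is defined. Sequences are indexed by the positive integers.
limsup_≤_ : (∀ n → .{{NonZero n}} → ℚ) → ℚ → Set
limsup a ≤ C = ∀ δ → 0ℚ < δ → ∃[ n₀ ] ∀ n → .{{_ : NonZero n}} → n₀ ℕ.≤ n → a n ≤ C + δ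

{-# OPTIONS --safe #-}
module Submission where

-- Take f = OR under the uniform distribution μ on {0,1}ᵐ, and ε = 2^-(m+1).
-- Every point has mass 2^-m > ε, so a tree with error at most ε is exact; at
-- the all-zero input every bit of OR is sensitive, hence D(f) ≥ m.
-- On the other hand, reading bits until the first 1 costs c queries with
-- E[(3/2)^c] ≤ 3. Running this on n independent blocks and giving up after 5n
-- queries fails, by Markov's inequality for (3/2)^(total cost), with
-- probability at most (3 · (2/3)^5)ⁿ ≤ 2^-n, which is at most ε once n > m.

open import Algebra.Bundles using (CommutativeRing)
import Algebra.Properties.CommutativeSemigroup as CommutativeSemigroup
import Algebra.Properties.CommutativeSemiring.Exp as Exp
open import Data.Bool using (Bool; true; false; if_then_else_; _∨_)
open import Data.Fin using (Fin; zero; suc; _↑ˡ_; _↑ʳ_)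
import Data.Fin.Properties as Fin
open import Data.Integer as ℤ using (+_)
import Data.Integer.Properties as ℤ
open import Data.List as List using (List; []; _∷_; filter)
open import Data.List.Membership.DecPropositional using (_∈?_)
open import Data.List.Membership.Propositional using (_∈_; _∉_)
open import Data.List.Membership.Propositional.Properties using (∈-filter⁺)
open import Data.List.Membership.Setoid.Properties using (index-injective)
open import Data.List.Relation.Unary.Any using (here; there)
open import Data.Nat as ℕ using (ℕ; zero; suc; NonZero; z≤n; s≤s)
import Data.Nat.Properties as ℕ
open import Data.Product using (Σ-syntax; ∃-syntax; _×_; _,_)
open import Data.Rational
  using (ℚ; 0ℚ; 1ℚ; ½; _+_; _*_; _≤_; _<_; _≤?_; _/_; Positive; nonNegative; fromℚᵘ)
import Data.Rational.Properties as ℚ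
import Data.Rational.Unnormalised as ℚᵘ
import Data.Rational.Unnormalised.Properties as ℚᵘ
open import Data.Vec using (Vec; []; _∷_; lookup; replicate; take; drop; _[_]≔_; foldr′)
open import Data.Vec.Properties using (lookup-++ˡ; lookup-++ʳ; take++drop≡id; map-cong; lookup∘update′)
open import Defs
open import Function using (_∘_)
open import Relation.Binary.PropositionalEquality
  using (_≡_; _≢_; _≗_; refl; sym; trans; cong; cong₂; subst; subst₂; setoid; module ≡-Reasoning)
open import Relation.Binary.TypeClasses using (IsDecEquivalence; _≟_)
open import Relation.Nullary using (yes; no; contradiction)
open import Relation.Nullary.Decidable using (from-yes)
open import Relation.Unary using (Pred; Decidable)

open Exp (CommutativeRing.commutativeSemiring ℚ.+-*-commutativeRing)
  using (_^_; ^-homo-*; ^-assocʳ; ^-distrib-*)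

open CommutativeSemigroup
  (CommutativeRing.*-commutativeSemigroup ℚ.+-*-commutativeRing)
  using () renaming (interchange to *-interchange)

private variable
  A V W : Set
  k m n N : ℕ

-- Rational inequalities and powers.

fromℚᵘ-mono-≤ : ∀ {p q} → p ℚᵘ.≤ q → fromℚᵘ p ≤ fromℚᵘ q
fromℚᵘ-mono-≤ {p} {q} p≤q = ℚ.toℚᵘ-cancel-≤
  (ℚᵘ.≤-respˡ-≃ (ℚᵘ.≃-sym (ℚ.toℚᵘ-fromℚᵘ p)) (ℚᵘ.≤-respʳ-≃ (ℚᵘ.≃-sym (ℚ.toℚᵘ-fromℚᵘ q)) p≤q))

-- Compared before reduction to lowest terms, where `≤` is cross-multiplication.
/-≤ : ∀ a c n → .{{_ : NonZero n}} → a ℕ.≤ n ℕ.* c → + a / n ≤ ℕ→ℚ c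
/-≤ a c (suc n) a≤nc = fromℚᵘ-mono-≤ {ℚᵘ.mkℚᵘ (+ a) n} {ℚᵘ.mkℚᵘ (+ c) 0}
  (ℚᵘ.*≤* (subst₂ ℤ._≤_ (sym (ℤ.*-identityʳ (+ a)))
    (trans (cong +_ (ℕ.*-comm (suc n) c)) (ℤ.pos-* c (suc n))) (ℤ.+≤+ a≤nc)))

ℕ→ℚ-mono-≤ : m ℕ.≤ n → ℕ→ℚ m ≤ ℕ→ℚ n
ℕ→ℚ-mono-≤ {m} {n} m≤n = /-≤ m n 1 (subst (m ℕ.≤_) (sym (ℕ.*-identityˡ n)) m≤n)

*-mono-≤-nonNeg : ∀ {p q r s} → 0ℚ ≤ q → 0ℚ ≤ r → p ≤ q → r ≤ s → p * r ≤ q * s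
*-mono-≤-nonNeg {p} {q} {r} {s} 0≤q 0≤r p≤q r≤s = ℚ.≤-trans
  (ℚ.*-monoʳ-≤-nonNeg r {{nonNegative 0≤r}} p≤q)
  (ℚ.*-monoˡ-≤-nonNeg q {{nonNegative 0≤q}} r≤s)

*-nonNeg : ∀ {p q} → 0ℚ ≤ p → 0ℚ ≤ q → 0ℚ ≤ p * q
*-nonNeg {p} {q} 0≤p 0≤q = subst (_≤ p * q) (ℚ.*-zeroʳ p)
  (ℚ.*-monoˡ-≤-nonNeg p {{nonNegative 0≤p}} 0≤q)

^-nonNeg : ∀ {p} → 0ℚ ≤ p → ∀ n → 0ℚ ≤ p ^ n
^-nonNeg 0≤p zero    = from-yes (0ℚ ≤? 1ℚ)
^-nonNeg 0≤p (suc n) = *-nonNeg 0≤p (^-nonNeg 0≤p n)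

^-monoˡ-≤ : ∀ {p q} → 0ℚ ≤ p → p ≤ q → ∀ n → p ^ n ≤ q ^ n
^-monoˡ-≤ 0≤p p≤q zero    = ℚ.≤-refl
^-monoˡ-≤ 0≤p p≤q (suc n) =
  *-mono-≤-nonNeg (ℚ.≤-trans 0≤p p≤q) (^-nonNeg 0≤p n) p≤q (^-monoˡ-≤ 0≤p p≤q n)

^-positive : ∀ p .{{_ : Positive p}} n → Positive (p ^ n)
^-positive p zero    = _
^-positive p (suc n) = ℚ.pos*pos⇒pos p (p ^ n) {{^-positive p n}}

1≤^ : ∀ {p} → 1ℚ ≤ p → ∀ n → 1ℚ ≤ p ^ n
1≤^ 1≤p zero    = ℚ.≤-refl
1≤^ 1≤p (suc n) = *-mono-≤-nonNeg (ℚ.≤-trans 0≤1 1≤p) 0≤1 1≤p (1≤^ 1≤p n)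
  where 0≤1 = from-yes (0ℚ ≤? 1ℚ)

-- Cancelling `d` pairs `p * q` leaves `p ^ (c - d)`. With `q = 1/p` this is the pointwise
-- inequality behind Markov's bound.
1≤^*^ : ∀ {p q} → p * q ≡ 1ℚ → 1ℚ ≤ p → ∀ {c d} → d ℕ.≤ c → 1ℚ ≤ p ^ c * q ^ d
1≤^*^ {p} {q} pq≡1 1≤p {c} {zero} z≤n = subst (1ℚ ≤_) (sym (ℚ.*-identityʳ (p ^ c))) (1≤^ 1≤p c)
1≤^*^ {p} {q} pq≡1 1≤p {suc c} {suc d} (s≤s d≤c) = subst (1ℚ ≤_) (sym eq) (1≤^*^ pq≡1 1≤p d≤c)
  where
  eq : (p * p ^ c) * (q * q ^ d) ≡ p ^ c * q ^ d
  eq = trans (*-interchange p (p ^ c) q (q ^ d))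
    (trans (cong (_* (p ^ c * q ^ d)) pq≡1) (ℚ.*-identityˡ (p ^ c * q ^ d)))

½^-antimono-≤ : m ℕ.≤ n → ½ ^ n ≤ ½ ^ m
½^-antimono-≤ {n = n} z≤n = subst (½ ^ n ≤_) (1^ n) (^-monoˡ-≤ (from-yes (0ℚ ≤? ½)) (from-yes (½ ≤? 1ℚ)) n)
  where
  1^ : ∀ n → 1ℚ ^ n ≡ 1ℚ
  1^ zero    = refl
  1^ (suc n) = trans (ℚ.*-identityˡ (1ℚ ^ n)) (1^ n)
½^-antimono-≤ (s≤s m≤n) = ℚ.*-monoˡ-≤-nonNeg ½ (½^-antimono-≤ m≤n)

-- Finite sums and the uniform distribution.

∑-cong : ∀ (xs : List A) {h h′} → h ≗ h′ → ∑ xs h ≡ ∑ xs h′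
∑-cong []       h≗h′ = refl
∑-cong (x ∷ xs) h≗h′ = cong₂ _+_ (h≗h′ x) (∑-cong xs h≗h′)

∑-*ʳ : ∀ c (xs : List A) h → ∑ xs (λ x → h x * c) ≡ ∑ xs h * c
∑-*ʳ c xs h = trans (∑-cong xs (λ x → ℚ.*-comm (h x) c)) (trans (∑-*ˡ c xs h) (ℚ.*-comm c (∑ xs h)))

∑-nonNeg : ∀ (xs : List A) {h} → (∀ x → 0ℚ ≤ h x) → 0ℚ ≤ ∑ xs h
∑-nonNeg []       h≥0 = ℚ.≤-refl
∑-nonNeg (x ∷ xs) h≥0 = ℚ.+-mono-≤ (h≥0 x) (∑-nonNeg xs h≥0)

∈⇒≤∑ : ∀ {xs : List A} {x} {h} → (∀ x → 0ℚ ≤ h x) → x ∈ xs → h x ≤ ∑ xs h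
∈⇒≤∑ {xs = x ∷ xs} {h = h} h≥0 (here refl) =
  subst (_≤ h x + ∑ xs h) (ℚ.+-identityʳ (h x)) (ℚ.+-monoʳ-≤ (h x) (∑-nonNeg xs h≥0))
∈⇒≤∑ {xs = x ∷ xs} {y} {h} h≥0 (there y∈xs) =
  subst (_≤ h x + ∑ xs h) (ℚ.+-identityˡ (h y)) (ℚ.+-mono-≤ (h≥0 x) (∈⇒≤∑ h≥0 y∈xs))

-- Terms that the filter drops on the left cost nothing, since `h′` is nonnegative there. It bounds
-- the probability of an event by an expectation.
∑-filter-≤ : ∀ {p} {P : Pred A p} (P? : Decidable P) {h h′ : A → ℚ} →
             (∀ x → 0ℚ ≤ h′ x) → (∀ x → P x → h x ≤ h′ x) →
             ∀ xs → ∑ (filter P? xs) h ≤ ∑ xs h′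
∑-filter-≤ P? h′≥0 h≤h′ [] = ℚ.≤-refl
∑-filter-≤ P? {h} {h′} h′≥0 h≤h′ (x ∷ xs) with ih ← ∑-filter-≤ P? h′≥0 h≤h′ xs | P? x
... | yes Px = ℚ.+-mono-≤ (h≤h′ x Px) ih
... | no  _  = subst (_≤ h′ x + ∑ xs h′) (ℚ.+-identityˡ (∑ (filter P? xs) h)) (ℚ.+-mono-≤ (h′≥0 x) ih)

∑-const : ∀ N → ∑ (bitStrings N) (λ _ → ½ ^ N) ≡ 1ℚ
∑-const zero    = refl
∑-const (suc N) = trans (∑-bits N (λ _ → ½ ^ suc N)) (cong₂ _+_ half half)
  where
  half : ∑ (bitStrings N) (λ _ → ½ ^ suc N) ≡ ½
  half = trans (∑-*ˡ ½ (bitStrings N) (λ _ → ½ ^ N)) (cong (½ *_) (∑-const N))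

uniform : ∀ N → Distribution N
pmf    (uniform N) _ = ½ ^ N
pmf≥0  (uniform N) _ = ^-nonNeg (from-yes (0ℚ ≤? ½)) N
∑pmf≡1 (uniform N)   = ∑-const N

-- Renaming queries, sequential composition and truncation of decision trees.

reindex : (Fin k → Fin N) → DecisionTree k W → DecisionTree N W
reindex ρ (leaf w)        = leaf w
reindex ρ (query i t₀ t₁) = query (ρ i) (reindex ρ t₀) (reindex ρ t₁)

module _ {ρ : Fin k → Fin N} {y : Vec Bool N} {z : Vec Bool k} (yρ≗z : ∀ i → lookup y (ρ i) ≡ lookup z i) where

  run-reindex : ∀ (T : DecisionTree k W) → run (reindex ρ T) y ≡ run T z
  run-reindex (leaf w) = refl
  run-reindex (query i t₀ t₁) rewrite yρ≗z i with lookup z i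
  ... | true  = run-reindex t₁
  ... | false = run-reindex t₀

  queries-reindex : ∀ (T : DecisionTree k W) → queries (reindex ρ T) y ≡ queries T z
  queries-reindex (leaf w) = refl
  queries-reindex (query i t₀ t₁) rewrite yρ≗z i with lookup z i
  ... | true  = cong suc (queries-reindex t₁)
  ... | false = cong suc (queries-reindex t₀)

-- Monadic bind: the continuation depends on the answer, and query counts add along each path.
graft : DecisionTree N W → (W → DecisionTree N V) → DecisionTree N V
graft (leaf w)        u = u w
graft (query i t₀ t₁) u = query i (graft t₀ u) (graft t₁ u)

run-graft : ∀ (T : DecisionTree N W) (u : W → DecisionTree N V) y →
            run (graft T u) y ≡ run (u (run T y)) y
run-graft (leaf w) u y = refl
run-graft (query i t₀ t₁) u y with lookup y i
... | true  = run-graft t₁ u y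
... | false = run-graft t₀ u y

queries-graft : ∀ (T : DecisionTree N W) (u : W → DecisionTree N V) y →
                queries (graft T u) y ≡ queries T y ℕ.+ queries (u (run T y)) y
queries-graft (leaf w) u y = refl
queries-graft (query i t₀ t₁) u y with lookup y i
... | true  = cong suc (queries-graft t₁ u y)
... | false = cong suc (queries-graft t₀ u y)

-- The default `w₀` is output only when a further query would exceed the budget; a path of exactly
-- `d` queries keeps its answer.
truncate : ℕ → W → DecisionTree N W → DecisionTree N W
truncate d       w₀ (leaf w)        = leaf w
truncate zero    w₀ (query i t₀ t₁) = leaf w₀
truncate (suc d) w₀ (query i t₀ t₁) = query i (truncate d w₀ t₀) (truncate d w₀ t₁)

queries-truncate : ∀ d w₀ (T : DecisionTree N W) y → queries (truncate d w₀ T) y ℕ.≤ d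
queries-truncate d       w₀ (leaf w)        y = z≤n
queries-truncate zero    w₀ (query i t₀ t₁) y = z≤n
queries-truncate (suc d) w₀ (query i t₀ t₁) y with lookup y i
... | true  = s≤s (queries-truncate d w₀ t₁ y)
... | false = s≤s (queries-truncate d w₀ t₀ y)

run-truncate : ∀ d w₀ (T : DecisionTree N W) y → queries T y ℕ.≤ d →
               run (truncate d w₀ T) y ≡ run T y
run-truncate d       w₀ (leaf w)        y _ = refl
run-truncate (suc d) w₀ (query i t₀ t₁) y (s≤s q≤d) with lookup y i
... | true  = run-truncate d w₀ t₁ y q≤d
... | false = run-truncate d w₀ t₀ y q≤d

-- Solving independent blocks one after another.

infixl 8 _^ᵗ_
_^ᵗ_ : DecisionTree m W → ∀ n → DecisionTree (n ℕ.* m) (Vec W n)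
_^ᵗ_     T zero    = leaf []
_^ᵗ_ {m} T (suc n) = graft (reindex (_↑ˡ n ℕ.* m) T)
  (λ w → graft (reindex (m ↑ʳ_) (T ^ᵗ n)) (leaf ∘ (w ∷_)))

lookup-take : ∀ m (y : Vec A (m ℕ.+ k)) i → lookup y (i ↑ˡ k) ≡ lookup (take m y) i
lookup-take {k = k} m y i = trans (cong (λ v → lookup v (i ↑ˡ k)) (sym (take++drop≡id m y)))
  (lookup-++ˡ (take m y) (drop m y) i)

lookup-drop : ∀ m (y : Vec A (m ℕ.+ k)) i → lookup y (m ↑ʳ i) ≡ lookup (drop m y) i
lookup-drop m y i = trans (cong (λ v → lookup v (m ↑ʳ i)) (sym (take++drop≡id m y)))
  (lookup-++ʳ (take m y) (drop m y) i)

run-^ᵗ : ∀ (T : DecisionTree m W) n y → run (T ^ᵗ n) y ≡ (run T ^ᶠ n) y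
run-^ᵗ     T zero    [] = refl
run-^ᵗ {m} T (suc n) y  =
  trans (run-graft (reindex (_↑ˡ n ℕ.* m) T) _ y)
  (trans (run-graft (reindex (m ↑ʳ_) (T ^ᵗ n)) _ y)
  -- `blocks (suc n) y` computes to `take m y ∷ blocks n (drop m y)`, so the head and the tail match
  -- the two grafted trees.
  (cong₂ _∷_ (run-reindex (lookup-take m y) T)
    (trans (run-reindex (lookup-drop m y) (T ^ᵗ n)) (run-^ᵗ T n (drop m y)))))

queries-^ᵗ-suc : ∀ (T : DecisionTree m W) n y →
                 queries (T ^ᵗ suc n) y ≡ queries T (take m y) ℕ.+ queries (T ^ᵗ n) (drop m y)
queries-^ᵗ-suc {m} T n y =
  trans (queries-graft (reindex (_↑ˡ n ℕ.* m) T) _ y)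
  (cong₂ ℕ._+_ (queries-reindex (lookup-take m y) T)
    (trans (queries-graft (reindex (m ↑ʳ_) (T ^ᵗ n)) _ y)
    (trans (ℕ.+-identityʳ _) (queries-reindex (lookup-drop m y) (T ^ᵗ n)))))

-- Exponential moments of the query count and the error of truncation.

moment : ℚ → Distribution N → DecisionTree N W → ℚ
moment {N} t ν T = ∑ (bitStrings N) (λ y → pmf ν y * t ^ queries T y)

-- Query counts add over the blocks and the blocks are independent, so the expectation of
-- `t ^ queries` factors.
moment-^ᵗ : ∀ t (μ : Distribution m) (T : DecisionTree m W) n →
            moment t (μ ^ᵈ n) (T ^ᵗ n) ≡ moment t μ T ^ n
moment-^ᵗ     t μ T zero    = refl
moment-^ᵗ {m} t μ T (suc n) = begin
  moment t (μ ^ᵈ suc n) (T ^ᵗ suc n)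
    ≡⟨ ∑-cong (bitStrings (suc n ℕ.* m)) split ⟩
  _ ≡⟨ ∑-split m (n ℕ.* m) (λ y → pmf μ y * t ^ queries T y)
      (λ y → pmf (μ ^ᵈ n) y * t ^ queries (T ^ᵗ n) y) ⟩
  moment t μ T * moment t (μ ^ᵈ n) (T ^ᵗ n)
    ≡⟨ cong (moment t μ T *_) (moment-^ᵗ t μ T n) ⟩
  moment t μ T ^ suc n ∎
  where
  open ≡-Reasoning
  split : ∀ y → pmf (μ ^ᵈ suc n) y * t ^ queries (T ^ᵗ suc n) y
              ≡ (pmf μ (take m y) * t ^ queries T (take m y))
              * (pmf (μ ^ᵈ n) (drop m y) * t ^ queries (T ^ᵗ n) (drop m y))
  split y = trans
    (cong (pmf (μ ^ᵈ suc n) y *_)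
      (trans (cong (t ^_) (queries-^ᵗ-suc T n y))
        (^-homo-* t (queries T (take m y)) (queries (T ^ᵗ n) (drop m y)))))
    (*-interchange (pmf μ (take m y)) _ _ _)

module _ {{_ : IsDecEquivalence {A = W} _≡_}} where

  -- Markov's inequality with `s = 1/t`: truncation can err only at inputs where `T` makes more than
  -- `d` queries, and there `t ^ queries T y * s ^ d` is at least 1.
  error-truncate : ∀ (ν : Distribution N) (T : DecisionTree N W) {g} → run T ≗ g → ∀ d w₀ {t s} →
                   t * s ≡ 1ℚ → 0ℚ ≤ s → 1ℚ ≤ t →
                   error ν (truncate d w₀ T) g ≤ moment t ν T * s ^ d
  error-truncate {N} ν T T≗g d w₀ {t} {s} ts≡1 0≤s 1≤t =
    subst (error ν (truncate d w₀ T) _ ≤_) (∑-*ʳ (s ^ d) (bitStrings N) (λ y → pmf ν y * t ^ queries T y))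
      (∑-filter-≤ _ (λ y → *-nonNeg (*-nonNeg (pmf≥0 ν y) (^-nonNeg 0≤t (queries T y))) (^-nonNeg 0≤s d))
        bound (bitStrings N))
    where
    0≤t : 0ℚ ≤ t
    0≤t = ℚ.≤-trans (from-yes (0ℚ ≤? 1ℚ)) 1≤t
    bound : ∀ y → run (truncate d w₀ T) y ≢ _ → pmf ν y ≤ pmf ν y * t ^ queries T y * s ^ d
    bound y wrong = subst₂ _≤_ (ℚ.*-identityʳ (pmf ν y)) (sym (ℚ.*-assoc (pmf ν y) _ _))
      (ℚ.*-monoˡ-≤-nonNeg (pmf ν y) {{nonNegative (pmf≥0 ν y)}} (1≤^*^ ts≡1 1≤t
        (ℕ.≰⇒≥ (λ q≤d → wrong (trans (run-truncate d w₀ T y q≤d) (T≗g y))))))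

  -- A single wrong input already contributes its whole mass to the error.
  error<pmf⇒exact : ∀ (ν : Distribution N) (T : DecisionTree N W) g → (∀ y → error ν T g < pmf ν y) →
                    run T ≗ g
  error<pmf⇒exact ν T g err<pmf y with run T y ≟ g y
  ... | yes eq = eq
  ... | no neq = contradiction
    (ℚ.≤-<-trans (∈⇒≤∑ (pmf≥0 ν) (∈-filter⁺ _ (∈-bitStrings y) neq)) (err<pmf y))
    (ℚ.<-irrefl refl)

-- Sensitivity lower bound on the number of queries.

queried : DecisionTree N W → Vec Bool N → List (Fin N)
queried (leaf w)        y = []
queried (query i t₀ t₁) y = i ∷ (if lookup y i then queried t₁ y else queried t₀ y)

length-queried : ∀ (T : DecisionTree N W) y → List.length (queried T y) ≡ queries T y
length-queried (leaf w) y = refl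
length-queried (query i t₀ t₁) y with lookup y i
... | true  = cong suc (length-queried t₁ y)
... | false = cong suc (length-queried t₀ y)

-- Every bit read on the path of `y` is unchanged, so the modified input follows the same path.
run-unqueried : ∀ (T : DecisionTree N W) y i b → i ∉ queried T y → run T (y [ i ]≔ b) ≡ run T y
run-unqueried (leaf w) y i b _ = refl
run-unqueried (query j t₀ t₁) y i b i∉
  rewrite lookup∘update′ {i = j} {i} (λ j≡i → i∉ (here (sym j≡i))) y b with lookup y j
... | true  = run-unqueried t₁ y i b (i∉ ∘ there)
... | false = run-unqueried t₀ y i b (i∉ ∘ there)

-- Each coordinate must occur among those queried on `y`. Sending it to its position in that list is
-- an injection from `Fin N`, so the list has length at least `N`.
fully-sensitive⇒≤queries : ∀ (T : DecisionTree N W) y b → (∀ i → run T (y [ i ]≔ b) ≢ run T y) →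
                           N ℕ.≤ queries T y
fully-sensitive⇒≤queries {N} T y b sensitive =
  subst (N ℕ.≤_) (length-queried T y)
    (Fin.injective⇒≤ (λ {i} {j} → index-injective (setoid _) (∈queried i) (∈queried j)))
  where
  ∈queried : ∀ i → i ∈ queried T y
  ∈queried i with _∈?_ Fin._≟_ i (queried T y)
  ... | yes i∈ = i∈
  ... | no  i∉ = contradiction (run-unqueried T y i b i∉) (sensitive i)

-- The OR function and its sequential decision tree.

or : Vec Bool N → Bool
or = foldr′ _∨_ false

or-0 : ∀ N → or (replicate N false) ≡ false
or-0 zero    = refl
or-0 (suc N) = or-0 N

or-0[i]≔1 : ∀ (i : Fin N) → or (replicate N false [ i ]≔ true) ≡ true
or-0[i]≔1 zero    = refl
or-0[i]≔1 (suc i) = or-0[i]≔1 i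

exact-or⇒≤queries : ∀ (T : DecisionTree N Bool) → run T ≗ or → N ℕ.≤ queries T (replicate N false)
exact-or⇒≤queries {N} T T≗or = fully-sensitive⇒≤queries T (replicate N false) true sensitive
  where
  sensitive : ∀ i → run T (replicate N false [ i ]≔ true) ≢ run T (replicate N false)
  sensitive i eq with () ← trans (sym (or-0[i]≔1 i))
    (trans (sym (T≗or (replicate N false [ i ]≔ true)))
    (trans eq (trans (T≗or (replicate N false)) (or-0 N))))

-- Under the uniform distribution its cost is a geometric variable cut off at `N`, which has a
-- bounded exponential moment.
orTree : ∀ N → DecisionTree N Bool
orTree zero    = leaf false
orTree (suc N) = query zero (shift (orTree N)) (leaf true)

run-orTree : ∀ N → run (orTree N) ≗ or
run-orTree zero    []          = refl
run-orTree (suc N) (true ∷ y)  = refl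
run-orTree (suc N) (false ∷ y) = trans (run-shift (orTree N) false y) (run-orTree N y)

³/₂ ²/₃ : ℚ
³/₂ = + 3 / 2
²/₃ = + 2 / 3

-- The moment M satisfies M (N + 1) = ½ · ³/₂ · (M N + 1), whose fixed point is 3.
moment-orTree-suc : ∀ N → moment ³/₂ (uniform (suc N)) (orTree (suc N))
                        ≡ (½ * ³/₂) * moment ³/₂ (uniform N) (orTree N) + (½ * ³/₂) * 1ℚ
moment-orTree-suc N = trans (∑-bits N (λ y → ½ ^ suc N * ³/₂ ^ queries (orTree (suc N)) y)) (cong₂ _+_
  (trans (∑-cong (bitStrings N) (λ y →
      trans (cong (λ q → ½ ^ suc N * ³/₂ ^ suc q) (queries-shift (orTree N) false y))
            (*-interchange ½ (½ ^ N) ³/₂ (³/₂ ^ queries (orTree N) y))))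
    (∑-*ˡ (½ * ³/₂) (bitStrings N) (λ y → ½ ^ N * ³/₂ ^ queries (orTree N) y)))
  (trans (∑-cong (bitStrings N) (λ y →
      trans (*-interchange ½ (½ ^ N) ³/₂ 1ℚ) (cong ((½ * ³/₂) *_) (ℚ.*-identityʳ (½ ^ N)))))
    (trans (∑-*ˡ (½ * ³/₂) (bitStrings N) (λ _ → ½ ^ N)) (cong ((½ * ³/₂) *_) (∑-const N)))))

moment-orTree : ∀ N → moment ³/₂ (uniform N) (orTree N) ≤ ℕ→ℚ 3
moment-orTree zero    = from-yes (1ℚ ≤? ℕ→ℚ 3)
moment-orTree (suc N) = subst (_≤ ℕ→ℚ 3) (sym (moment-orTree-suc N))
  -- The induction closes because 3/4 · 3 + 3/4 evaluates to 3.
  (ℚ.+-monoˡ-≤ ((½ * ³/₂) * 1ℚ) (ℚ.*-monoˡ-≤-nonNeg (½ * ³/₂) (moment-orTree N)))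

-- Bounds on `D` for OR and its powers, and the conclusion.

D-or-lower : ∀ m → m ℕ.≤ D (uniform m) (½ ^ suc m) or
D-or-lower m with D-attained (uniform m) (^-nonNeg (from-yes (0ℚ ≤? ½)) (suc m)) or
... | T , err≤ε , T≡D = subst (m ℕ.≤_) T≡D (ℕ.≤-trans
  (exact-or⇒≤queries T (error<pmf⇒exact (uniform m) T or (λ _ → ℚ.≤-<-trans err≤ε ε<mass)))
  (queries≤maxQueries (uniform m) T
    -- The all-zero input has positive mass, so its query count enters the maximum over the support.
    (∈-filter⁺ (λ y → 0ℚ ℚ.<? pmf (uniform m) y) (∈-bitStrings (replicate m false))
      (ℚ.positive⁻¹ _ {{^-positive ½ m}}))))
  where
  ε<mass : ½ ^ suc m < ½ ^ m
  ε<mass = subst (½ ^ suc m <_) (ℚ.*-identityˡ (½ ^ m))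
    (ℚ.*-monoˡ-<-pos (½ ^ m) {{^-positive ½ m}} (from-yes (½ ℚ.<? 1ℚ)))

D-or-upper : ∀ m n → m ℕ.< n → D (uniform m ^ᵈ n) (½ ^ suc m) (or ^ᶠ n) ℕ.≤ n ℕ.* 5
D-or-upper m n m<n = ℕ.≤-trans
  (D-minimal (uniform m ^ᵈ n) (or ^ᶠ n) T error≤ε)
  (maxQueries-lub (uniform m ^ᵈ n) T (λ y _ → queries-truncate (n ℕ.* 5) w₀ (orTree m ^ᵗ n) y))
  where
  w₀ : Vec Bool n
  w₀ = replicate n false
  T : DecisionTree (n ℕ.* m) (Vec Bool n)
  T = truncate (n ℕ.* 5) w₀ (orTree m ^ᵗ n)
  M : ℚ
  M = moment ³/₂ (uniform m) (orTree m)
  exact : run (orTree m ^ᵗ n) ≗ or ^ᶠ n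
  exact y = trans (run-^ᵗ (orTree m) n y) (map-cong (run-orTree m) (blocks n y))
  M≥0 : 0ℚ ≤ M
  M≥0 = ∑-nonNeg (bitStrings m) (λ y →
    *-nonNeg (pmf≥0 (uniform m) y) (^-nonNeg (from-yes (0ℚ ≤? ³/₂)) (queries (orTree m) y)))
  rate : M * ²/₃ ^ 5 ≤ ½
  -- Here 3 · (2/3)^5 = 32/81. The exponent 5 is the least that brings this product down to 1/2, and
  -- it becomes the query budget per block.
  rate = ℚ.≤-trans (ℚ.*-monoʳ-≤-nonNeg (²/₃ ^ 5) (moment-orTree m)) (from-yes (ℕ→ℚ 3 * ²/₃ ^ 5 ≤? ½))
  error≤ε : error (uniform m ^ᵈ n) T (or ^ᶠ n) ≤ ½ ^ suc m
  error≤ε = begin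
    error (uniform m ^ᵈ n) T (or ^ᶠ n)
      ≤⟨ error-truncate (uniform m ^ᵈ n) (orTree m ^ᵗ n) exact (n ℕ.* 5) w₀ {³/₂} {²/₃} refl
           (from-yes (0ℚ ≤? ²/₃)) (from-yes (1ℚ ≤? ³/₂)) ⟩
    moment ³/₂ (uniform m ^ᵈ n) (orTree m ^ᵗ n) * ²/₃ ^ (n ℕ.* 5)
      ≡⟨ cong₂ _*_ (moment-^ᵗ ³/₂ (uniform m) (orTree m) n)
           (trans (cong (²/₃ ^_) (ℕ.*-comm n 5)) (sym (^-assocʳ ²/₃ 5 n))) ⟩
    M ^ n * (²/₃ ^ 5) ^ n
      ≡⟨ ^-distrib-* M (²/₃ ^ 5) n ⟨
    (M * ²/₃ ^ 5) ^ n
      ≤⟨ ^-monoˡ-≤ (*-nonNeg M≥0 (from-yes (0ℚ ≤? ²/₃ ^ 5))) rate n ⟩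
    ½ ^ n
      -- The failure probability decays in `n` while the error parameter is fixed by `m`; `m < n` is
      -- by definition `suc m ≤ n`.
      ≤⟨ ½^-antimono-≤ m<n ⟩
    ½ ^ suc m ∎
    where open ℚ.≤-Reasoning

corollary1 : Σ[ f ∈ (∀ m → .{{NonZero m}} → Vec Bool m → Bool) ]
    Σ[ μ ∈ (∀ m → .{{NonZero m}} → Distribution m) ]
    Σ[ ε ∈ (∀ m → .{{NonZero m}} → ℚ) ]
    (∀ m → .{{_ : NonZero m}} → 0ℚ < ε m)
    × (∃[ C ] ∃[ m₀ ] ∀ m → .{{_ : NonZero m}} → m₀ ℕ.≤ m →
    limsup (λ n → + D (μ m ^ᵈ n) (ε m) (f m ^ᶠ n) / n) ≤ C)
    × (∃[ c ] 0ℚ < c × (∃[ m₀ ] ∀ m → .{{_ : NonZero m}} → m₀ ℕ.≤ m →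
    c * ℕ→ℚ m ≤ ℕ→ℚ (D (μ m) (ε m) (f m))))
corollary1 = (λ m → or) , (λ m → uniform m) , (λ m → ½ ^ suc m)
  , (λ m → ℚ.positive⁻¹ _ {{^-positive ½ (suc m)}})
  -- The constant 5 serves every `m`; only the threshold `suc m` for `n` grows with `m`. From there
  -- on the bound holds even without the slack `δ`.
  , (ℕ→ℚ 5 , 0 , λ m _ δ 0<δ → suc m , λ n m<n → ℚ.≤-trans
      (/-≤ (D (uniform m ^ᵈ n) (½ ^ suc m) (or ^ᶠ n)) 5 n (D-or-upper m n m<n))
      (subst (_≤ ℕ→ℚ 5 + δ) (ℚ.+-identityʳ (ℕ→ℚ 5)) (ℚ.+-monoʳ-≤ (ℕ→ℚ 5) (ℚ.<⇒≤ 0<δ))))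
  , (1ℚ , from-yes (0ℚ ℚ.<? 1ℚ) , 0 , λ m _ →
      subst (_≤ ℕ→ℚ (D (uniform m) (½ ^ suc m) or)) (sym (ℚ.*-identityˡ (ℕ→ℚ m)))
        (ℕ→ℚ-mono-≤ (D-or-lower m)))
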